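{- Every pinwheel covering instance $(a_1,\dots,a_n)$ of positive integers with $\sum_{j=1}^n \frac{1}{a_j}\geq 1.3$ is schedulable.
   Context: A pinwheel covering instance is a finite list $(a_1,\dots,a_n)$ of positive integers. A schedule $f:\mathbb{N}\to\{1,\dots,n\}$ assigns each day to exactly one job. It is valid if for every $i$, every block of $a_i$ consecutive days contains at most one day assigned to job $i$. The instance is schedulable if a valid schedule exists. -}

module Defs where

open import Data.Nat using (ℕ; zero; suc; _+_; _≤_; _<_)
open import Data.Fin using (Fin; zero; suc)
open import Data.Integer using (+_)
open import Data.Rational using (ℚ; _/_; 0ℚ) renaming (_+_ to _+ℚ_)
open import Data.Product using (Σ)
open import Relation.Binary.PropositionalEquality using (_≡_)

-- A pinwheel covering instance (a_1,…,a_n): a finite family of naturals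
-- (positivity is a separate hypothesis in the theorem).
Instance : ℕ → Set
Instance n = Fin n → ℕ

-- 1/a as a rational; the value at a = 0 is irrelevant (a > 0 is assumed).
recip : ℕ → ℚ
recip zero    = 0ℚ
recip (suc k) = + 1 / suc k

densitySum : ∀ {n} → Instance n → ℚ
densitySum {zero}  a = 0ℚ
densitySum {suc n} a = recip (a zero) +ℚ densitySum (λ i → a (suc i))

Schedule : ℕ → Set
Schedule n = ℕ → Fin n

Valid : ∀ {n} → Instance n → Schedule n → Set
Valid {n} a f = (i : Fin n) (t d d' : ℕ) →
  t ≤ d → d < t + a i → t ≤ d' → d' < t + a i →
  f d ≡ i → f d' ≡ i → d ≡ d'

Schedulable : ∀ {n} → Instance n → Set
Schedulable {n} a = Σ (Schedule n) (λ f → Valid a f)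

{-# OPTIONS --safe #-}

-- Two jobs with periods a ≤ b may share the slots of a single job with period ⌈b/2⌉.
-- Starting from the longest periods, all periods above 13 are eliminated in this way;
-- a job whose period exceeds twice the next one is simply dropped.  If a job of period
-- m is weighted by (about) 1/(m − 1), rounding up costs nothing, and the losses telescope:
-- the total weight plus the weight of the longest job never decreases.  What remains is
-- a finite problem: every multiset of periods ≤ 13 with this quantity at least 1.3
-- contains, up to shortening periods, one of a list of instances with explicit cyclic schedules.
module Submission where

open import Defs

-- Shorter periods and additional jobs only make an instance easier, so density is a resource to be
-- spent. Merging `b ≥ c` is guaranteed to return only `weight b + weight b`, so up to
-- `weight c - weight b` is lost. The extra summand absorbs this: it is the weight of an upper bound
-- `a ≥ b` of the list, and when `c` takes over as the bound it grows by at least that amount. At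
-- the end there is a single surplus term, at most the weight of the longest remaining job; this is
-- why the finite problem counts that job twice.

module Schedules where

  open import Data.Bool using (Bool; true; false; not; _∧_; T; if_then_else_)
  open import Data.Bool.Properties using (not-¬; T-∧)
  open import Data.Empty using (⊥)
  open import Data.Fin using (Fin; zero; suc; toℕ; fromℕ<; cast)
  open import Data.Fin.Properties using (suc-injective; toℕ-injective; toℕ-cast; toℕ-fromℕ<)
  open import Data.List using (List; []; _∷_; _∷ʳ_; _++_; lookup; length; tabulate)
  open import Data.List.Properties using (++-assoc; ++-identityʳ; lookup-tabulate; length-tabulate)
  import Data.List.Relation.Binary.Permutation.Homogeneous as Perm
  open import Data.List.Relation.Binary.Permutation.Propositional using (_↭_; ↭⇒↭ₛ)
  import Data.List.Relation.Binary.Permutation.Setoid.Properties as Perm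
  open import Data.Nat using (ℕ; zero; suc; pred; _+_; _*_; _∸_; _≤_; _<_; _<ᵇ_; _≡ᵇ_; s<s⁻¹; NonZero; _%_; _/_; ⌈_/2⌉)
  open import Data.Nat.DivMod using (m≡m%n+[m/n]*n; m%n<n)
  open import Data.Nat.Properties hiding (suc-injective)
  open import Data.Product using (Σ; ∃; _×_; _,_; proj₁; proj₂)
  open import Data.Sum using (_⊎_; inj₁; inj₂)
  open import Function using (_∘_; _∘′_)
  open import Function.Bundles using (module Equivalence; module Inverse)
  open import Relation.Binary.PropositionalEquality using (_≡_; _≢_; refl; sym; trans; cong; subst; setoid; module ≡-Reasoning)
  open import Relation.Nullary using (contradiction)
  open Equivalence using (to)

  -- Schedules described by gaps, and relabelling of jobs

  Spaced : {I : Set} → (I → ℕ) → (ℕ → I) → Set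
  Spaced p f = ∀ d k → f d ≡ f (d + suc k) → p (f d) ≤ suc k

  SchedulableList : List ℕ → Set
  SchedulableList xs = Σ (ℕ → Fin (length xs)) (Spaced (lookup xs))

  spaced⇒valid : ∀ {n} (a : Instance n) (f : Schedule n) → Spaced a f → Valid a f
  spaced⇒valid a f sp i t d d' t≤d d<t+a t≤d' d'<t+a fd fd' = ≤-antisym
    (≮⇒≥ λ d'<d → earlier fd' fd t≤d' d<t+a d'<d)
    (≮⇒≥ λ d<d' → earlier fd fd' t≤d d'<t+a d<d')
    where
    earlier : ∀ {u v} → f u ≡ i → f v ≡ i → t ≤ u → v < t + a i → u < v → ⊥
    earlier {u} {v} refl fv t≤u v<t+a u<v = <-irrefl refl (begin-strict
      v                       <⟨ v<t+a ⟩
      t + a (f u)             ≤⟨ +-mono-≤ t≤u (sp u k (trans (sym fv) (cong f (sym eq)))) ⟩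
      u + suc k               ≡⟨ eq ⟩
      v                       ∎)
      where
      open ≤-Reasoning
      k = v ∸ suc u
      eq : u + suc k ≡ v
      eq = trans (+-suc u k) (m+[n∸m]≡n u<v)

  -- Gaps are only bounded from below, so jobs outside the image of `h` may never run and shorter
  -- periods do no harm. Permuting, adding and shortening jobs are all instances of this.
  embed : ∀ {I J : Set} (p : I → ℕ) {q : J → ℕ} (h : J → I) →
          (∀ {j j'} → h j ≡ h j' → j ≡ j') → (∀ j → p (h j) ≤ q j) →
          ∀ f → Spaced q f → Spaced p (h ∘ f)
  embed p h inj le f sp d k eq = ≤-trans (le (f d)) (sp d k (inj eq))

  schedulable-↭ : ∀ {xs ys} → xs ↭ ys → SchedulableList xs → SchedulableList ys
  schedulable-↭ {xs} {ys} xs↭ys (f , sp) =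
    index ∘ f , embed (lookup ys) index (λ {i} {j} → injective) (λ i → ≤-reflexive (sym (Perm.onIndices-lookup (setoid ℕ) p i))) f sp
    where
    p = ↭⇒↭ₛ xs↭ys
    open Inverse (Perm.onIndices p) using (strictlyInverseʳ) renaming (to to index; from to index⁻¹)
    injective : ∀ {i j} → index i ≡ index j → i ≡ j
    injective {i} {j} eq = trans (sym (strictlyInverseʳ i)) (trans (cong index⁻¹ eq) (strictlyInverseʳ j))

  schedulable-∷ : ∀ {x xs} → SchedulableList xs → SchedulableList (x ∷ xs)
  schedulable-∷ {x} {xs} (f , sp) = suc ∘ f , embed (lookup (x ∷ xs)) suc suc-injective (λ _ → ≤-refl) f sp

  schedulable-tabulate : ∀ {n} (a : Fin n → ℕ) → SchedulableList (tabulate a) → Schedulable a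
  schedulable-tabulate {n} a (f , sp) = h ∘ f , spaced⇒valid a (h ∘ f) (embed a h inj le f sp)
    where
    h : Fin (length (tabulate a)) → Fin n
    h = cast (length-tabulate a)
    inj : ∀ {j j'} → h j ≡ h j' → j ≡ j'
    inj {j} {j'} eq = toℕ-injective (trans (sym (toℕ-cast _ j)) (trans (cong toℕ eq) (toℕ-cast _ j')))
    le : ∀ j → a (h j) ≤ lookup (tabulate a) j
    le j = ≤-reflexive (trans (sym (lookup-tabulate a (h j))) (cong (lookup (tabulate a)) (toℕ-injective (trans (toℕ-cast _ (h j)) (toℕ-cast _ j)))))

  -- Merging two jobs into one

  isZero : ∀ {n} → Fin n → Bool
  isZero zero    = true
  isZero (suc _) = false

  side : ∀ {n} → Bool → Fin (suc n) → Fin (suc (suc n))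
  side b     (suc j) = suc (suc j)
  side false zero    = zero
  side true  zero    = suc zero

  side-injective : ∀ {n b b'} {x y : Fin (suc n)} → side b x ≡ side b' y → x ≡ y × (x ≡ zero → b ≡ b')
  side-injective {b = false} {false} {zero}  {zero}  refl = refl , λ _ → refl
  side-injective {b = true}  {true}  {zero}  {zero}  refl = refl , λ _ → refl
  side-injective {b = false} {true}  {zero}  {zero}  ()
  side-injective {b = true}  {false} {zero}  {zero}  ()
  side-injective {x = suc x} {suc .x} refl = refl , λ ()

  -- The number of days before `d` given to the merged job `zero`, modulo 2; it decides which of the
  -- two original jobs takes the slot.
  parity : ∀ {n} → (ℕ → Fin (suc n)) → ℕ → Bool
  parity f zero    = false
  parity f (suc d) = if isZero (f d) then not (parity f d) else parity f d

  alternate : ∀ {n} → (ℕ → Fin (suc n)) → ℕ → Fin (suc (suc n))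
  alternate f d = side (parity f d) (f d)

  -- Day `d` itself flips the parity, and it can change again only at a later slot of the merged
  -- job. The second alternative records such a slot strictly between the two days, with both gaps.
  parity-flip : ∀ {n} (f : ℕ → Fin (suc n)) d → f d ≡ zero → ∀ k →
    parity f (d + suc k) ≡ not (parity f d) ⊎
    (∃ λ i → ∃ λ j → suc i + suc j ≡ suc k × f (d + suc i) ≡ zero)
  parity-flip f d fd zero rewrite +-suc d 0 | +-identityʳ d | fd = inj₁ refl
  parity-flip f d fd (suc k) with parity-flip f d fd k
  ... | inj₂ (i , j , eq , fe) = inj₂ (i , suc j , trans (+-suc (suc i) (suc j)) (cong suc eq) , fe)
  ... | inj₁ eq with f (d + suc k) in fe
  ...   | zero  = inj₂ (k , 0 , +-comm (suc k) 1 , fe)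
  ...   | suc _ rewrite +-suc d (suc k) | fe = inj₁ eq

  n≤2⌈n/2⌉ : ∀ n → n ≤ ⌈ n /2⌉ + ⌈ n /2⌉
  n≤2⌈n/2⌉ n = ≤-trans (≤-reflexive (sym (⌊n/2⌋+⌈n/2⌉≡n n))) (+-monoˡ-≤ ⌈ n /2⌉ (⌊n/2⌋≤⌈n/2⌉ n))

  -- Two occurrences of the same half of the merged job have an occurrence of the
  -- other half between them.
  merge : ∀ {a b xs} → a ≤ b → SchedulableList (⌈ b /2⌉ ∷ xs) → SchedulableList (b ∷ a ∷ xs)
  merge {a} {b} {xs} a≤b (f , sp) = alternate f , spaced
    where
    spaced : Spaced (lookup (b ∷ a ∷ xs)) (alternate f)
    spaced d k eq with side-injective {x = f d} eq
    ... | fd≡fd' , par with f d in fd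
    ...   | suc j rewrite sym fd = subst (λ i → lookup (⌈ b /2⌉ ∷ xs) i ≤ suc k) fd (sp d k fd≡fd')
    ...   | zero with parity-flip f d fd k
    ...     | inj₁ flip = contradiction (trans (sym flip) (sym (par refl))) (not-¬ refl ∘ sym)
    -- The gaps on both sides of the intermediate slot are at least `⌈ b /2⌉` and add up to `suc k`;
    -- neither job requires more than `b`.
    ...     | inj₂ (i , j , i+j , fe) = ≤-trans (atMost (parity f d)) (≤-trans (n≤2⌈n/2⌉ b) (≤-trans (+-mono-≤ left right) (≤-reflexive i+j)))
      where
      atMost : ∀ c → lookup (b ∷ a ∷ xs) (side c zero) ≤ b
      atMost false = ≤-refl
      atMost true  = a≤b
      left : ⌈ b /2⌉ ≤ suc i
      left = subst (λ z → lookup (⌈ b /2⌉ ∷ xs) z ≤ suc i) fd (sp d i (trans fd (sym fe)))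
      right : ⌈ b /2⌉ ≤ suc j
      right = subst (λ z → lookup (⌈ b /2⌉ ∷ xs) z ≤ suc j) fe
        (sp (d + suc i) j (trans fe (trans fd≡fd' (cong f (trans (cong (d +_) (sym i+j)) (sym (+-assoc d (suc i) (suc j))))))))

  -- Cyclic words as schedules

  rotate : List ℕ → List ℕ
  rotate []       = []
  rotate (x ∷ xs) = xs ∷ʳ x

  rotations : ℕ → List ℕ → List ℕ
  rotations zero    w = w
  rotations (suc d) w = rotations d (rotate w)

  rotations-+ : ∀ d e w → rotations (d + e) w ≡ rotations e (rotations d w)
  rotations-+ zero    e w = refl
  rotations-+ (suc d) e w = rotations-+ d e (rotate w)

  rotations-++ : ∀ xs ys → rotations (length xs) (xs ++ ys) ≡ ys ++ xs
  rotations-++ []       ys = sym (++-identityʳ ys)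
  rotations-++ (x ∷ xs) ys = begin
    rotations (length xs) ((xs ++ ys) ∷ʳ x)   ≡⟨ cong (rotations (length xs)) (++-assoc xs ys _) ⟩
    rotations (length xs) (xs ++ (ys ∷ʳ x))   ≡⟨ rotations-++ xs (ys ∷ʳ x) ⟩
    (ys ∷ʳ x) ++ xs                           ≡⟨ ++-assoc ys _ xs ⟩
    ys ++ x ∷ xs                              ∎
    where open ≡-Reasoning

  rotations-length : ∀ w → rotations (length w) w ≡ w
  rotations-length w = subst (λ u → rotations (length w) u ≡ w) (++-identityʳ w) (rotations-++ w [])

  rotations-* : ∀ q w → rotations (q * length w) w ≡ w
  rotations-* zero    w = refl
  rotations-* (suc q) w = trans (rotations-+ (length w) (q * length w) w)
    (trans (cong (rotations (q * length w)) (rotations-length w)) (rotations-* q w))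

  rotations-% : ∀ d w .{{_ : NonZero (length w)}} → rotations d w ≡ rotations (d % length w) w
  rotations-% d w = begin
    rotations d w                                  ≡⟨ cong (λ e → rotations e w) (trans (m≡m%n+[m/n]*n d (length w)) (+-comm (d % length w) _)) ⟩
    rotations (d / length w * length w + d % length w) w
                                                   ≡⟨ rotations-+ (d / length w * length w) (d % length w) w ⟩
    rotations (d % length w) (rotations (d / length w * length w) w)
                                                   ≡⟨ cong (rotations (d % length w)) (rotations-* (d / length w) w) ⟩
    rotations (d % length w) w                     ∎
    where open ≡-Reasoning

  head₀ : List ℕ → ℕ
  head₀ []      = 0
  head₀ (x ∷ _) = x

  -- Junk value 0 if there is no job labelled i.
  periodOf : List ℕ → ℕ → ℕ
  periodOf []       _       = 0
  periodOf (p ∷ ps) zero    = p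
  periodOf (p ∷ ps) (suc i) = periodOf ps i

  -- False if the list is too short, so a word realizes only periods up to its length.
  absent : ℕ → ℕ → List ℕ → Bool
  absent x zero    _        = true
  absent x (suc n) []       = false
  absent x (suc n) (y ∷ ys) = not (x ≡ᵇ y) ∧ absent x n ys

  -- A gap of at least the period `p` means that the next `p - 1` letters differ from `x`, hence the
  -- `pred`.
  headOK : List ℕ → List ℕ → Bool
  headOK ps []       = false
  headOK ps (x ∷ xs) = (x <ᵇ length ps) ∧ absent x (pred (periodOf ps x)) xs

  rotationsOK : List ℕ → ℕ → List ℕ → Bool
  rotationsOK ps zero    w = true
  rotationsOK ps (suc n) w = headOK ps w ∧ rotationsOK ps n (rotate w)

  realizes : List ℕ → List ℕ → Bool
  realizes ps []        = false
  realizes ps w@(_ ∷ _) = rotationsOK ps (length w) w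

  -- Rotation moves letters to the far end, so the first `n` letters of `w` still surface in order;
  -- `zs` collects the moved ones and makes the induction go through.
  absent-sound : ∀ x n w zs j → T (absent x n w) → j < n → head₀ (rotations j (w ++ zs)) ≢ x
  absent-sound x (suc n) (y ∷ ys) zs zero    ok _   eq rewrite eq with x ≡ᵇ x | ≡⇒≡ᵇ x x refl
  ... | true | _ = ok
  absent-sound x (suc n) (y ∷ ys) zs (suc j) ok j<n eq =
    absent-sound x n ys (zs ∷ʳ y) j (proj₂ (to T-∧ ok)) (s<s⁻¹ j<n)
      (trans (cong (head₀ ∘′ rotations j) (sym (++-assoc ys zs _))) eq)

  headOK-sound : ∀ ps w k → T (headOK ps w) → head₀ w ≡ head₀ (rotations (suc k) w) →
                 periodOf ps (head₀ w) ≤ suc k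
  headOK-sound ps (x ∷ xs) k ok eq = ≮⇒≥ λ k<p →
    absent-sound x _ xs _ k (proj₂ (to T-∧ ok)) (<⇒≤pred k<p) (sym eq)

  rotationsOK-sound : ∀ ps n w d → T (rotationsOK ps n w) → d < n → T (headOK ps (rotations d w))
  rotationsOK-sound ps (suc n) w zero    ok _   = proj₁ (to T-∧ ok)
  rotationsOK-sound ps (suc n) w (suc d) ok d<n = rotationsOK-sound ps n (rotate w) d (proj₂ (to T-∧ ok)) (s<s⁻¹ d<n)

  headOK-< : ∀ ps w → T (headOK ps w) → head₀ w < length ps
  headOK-< ps (x ∷ xs) ok = <ᵇ⇒< x (length ps) (proj₁ (to T-∧ ok))

  periodOf-lookup : ∀ ps i → periodOf ps (toℕ i) ≡ lookup ps i
  periodOf-lookup (p ∷ ps) zero    = refl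
  periodOf-lookup (p ∷ ps) (suc i) = periodOf-lookup ps i

  realizes-sound : ∀ ps w → T (realizes ps w) → SchedulableList ps
  realizes-sound ps w@(_ ∷ _) ok = f , spaced
    where
    good : ∀ d → T (headOK ps (rotations d w))
    -- By periodicity, the finitely many rotations checked stand for all days.
    good d = subst (λ u → T (headOK ps u)) (sym (rotations-% d w))
      (rotationsOK-sound ps (length w) w (d % length w) ok (m%n<n d (length w)))
    label : ℕ → ℕ
    label d = head₀ (rotations d w)
    f : ℕ → Fin (length ps)
    f d = fromℕ< (headOK-< ps (rotations d w) (good d))
    toℕ-f : ∀ d → toℕ (f d) ≡ label d
    toℕ-f d = toℕ-fromℕ< (headOK-< ps (rotations d w) (good d))
    spaced : Spaced (lookup ps) f
    spaced d k eq = subst (_≤ suc k) (trans (cong (periodOf ps) (sym (toℕ-f d))) (periodOf-lookup ps (f d)))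
      (headOK-sound ps (rotations d w) k (good d) (begin
        label d                                       ≡⟨ sym (toℕ-f d) ⟩
        toℕ (f d)                                     ≡⟨ cong toℕ eq ⟩
        toℕ (f (d + suc k))                           ≡⟨ toℕ-f (d + suc k) ⟩
        label (d + suc k)                             ≡⟨ cong head₀ (rotations-+ d (suc k) w) ⟩
        head₀ (rotations (suc k) (rotations d w))     ∎))
      where open ≡-Reasoning

  -- The jobs of `xs` beyond the length of `ps` stay idle. On ascending lists, comparing position by
  -- position loses nothing against an arbitrary injective matching.
  data Dominates : List ℕ → List ℕ → Set where
    []  : ∀ {xs} → Dominates [] xs
    _∷_ : ∀ {p ps x xs} → x ≤ p → Dominates ps xs → Dominates (p ∷ ps) (x ∷ xs)

  dominates-index : ∀ {ps xs} → Dominates ps xs → Fin (length ps) → Fin (length xs)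
  dominates-index (_ ∷ dom) zero    = zero
  dominates-index (_ ∷ dom) (suc i) = suc (dominates-index dom i)

  dominates-injective : ∀ {ps xs} (dom : Dominates ps xs) {i j} →
                        dominates-index dom i ≡ dominates-index dom j → i ≡ j
  dominates-injective (_ ∷ dom) {zero}  {zero}  eq = refl
  dominates-injective (_ ∷ dom) {suc i} {suc j} eq = cong suc (dominates-injective dom (suc-injective eq))

  dominates-≤ : ∀ {ps xs} (dom : Dominates ps xs) i → lookup xs (dominates-index dom i) ≤ lookup ps i
  dominates-≤ (x≤p ∷ _) zero    = x≤p
  dominates-≤ (_ ∷ dom) (suc i) = dominates-≤ dom i

  schedulable-dominates : ∀ {ps xs} → Dominates ps xs → SchedulableList ps → SchedulableList xs
  schedulable-dominates {xs = xs} dom (f , sp) =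
    dominates-index dom ∘ f , embed (lookup xs) (dominates-index dom) (dominates-injective dom) (dominates-≤ dom) f sp

-- The finite problem: periods at most 13

module Search where

  open Schedules
  open import Data.Bool using (Bool; true; false; _∧_; _∨_; T; if_then_else_)
  open import Data.Bool.ListAction using (any; all)
  open import Data.Bool.Properties using (T-∧; T-∨; T-≡)
  open import Data.List using (List; []; _∷_; null; map)
  open import Data.List.Membership.Propositional using (_∈_)
  open import Data.List.Membership.Propositional.Properties using (∈-map⁻)
  open import Data.List.Relation.Unary.All as All using (All; []; _∷_)
  open import Data.List.Relation.Unary.All.Properties using (all⁺)
  open import Data.List.Relation.Unary.Any using (here; there)
  open import Data.List.Relation.Unary.Linked using (Linked; []; [-]; _∷_)
  open import Data.Nat using (ℕ; zero; suc; pred; _+_; _∸_; _⊓′_; _≤_; _<_; _≤ᵇ_; _<ᵇ_; s≤s; s≤s⁻¹; _%_; _/_)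
  open import Data.Nat.DivMod using (/-monoʳ-≤)
  open import Data.Nat.ListAction using (sum)
  open import Data.Nat.Properties
  open import Data.Product using (∃; _×_; _,_; proj₁; proj₂)
  open import Data.Sum using (_⊎_; inj₁; inj₂)
  open import Function using (_∘_)
  open import Function.Bundles using (module Equivalence)
  open import Relation.Binary.PropositionalEquality using (_≡_; refl; sym; cong; subst)
  open import Relation.Nullary using (yes; no; contradiction)
  open Equivalence using (to; from)

  -- 2 / scale m stands for the density 1 / m of a job with period m.  A job of period
  -- m ≥ 7 may be the result of repeatedly halving a longer one and rounding up, so its
  -- true period is only known to exceed m − 1 (and to be at least 13/2 if m = 7, since
  -- only periods above 13 are halved).
  scale : ℕ → ℕ
  scale 0 = 0
  scale 1 = 2
  scale 2 = 4
  scale 3 = 6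
  scale 4 = 8
  scale 5 = 10
  scale 6 = 12
  scale 7 = 13
  scale (suc m) = m + m

  scale-step : ∀ m → scale m ≤ scale (suc m)
  scale-step 0 = ≤ᵇ⇒≤ _ _ _
  scale-step 1 = ≤ᵇ⇒≤ _ _ _
  scale-step 2 = ≤ᵇ⇒≤ _ _ _
  scale-step 3 = ≤ᵇ⇒≤ _ _ _
  scale-step 4 = ≤ᵇ⇒≤ _ _ _
  scale-step 5 = ≤ᵇ⇒≤ _ _ _
  scale-step 6 = ≤ᵇ⇒≤ _ _ _
  scale-step 7 = ≤ᵇ⇒≤ _ _ _
  scale-step (suc m@(suc (suc (suc (suc (suc (suc (suc _)))))))) = +-mono-≤ (n≤1+n m) (n≤1+n m)

  scale-mono : ∀ {m n} → m ≤ n → scale m ≤ scale n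
  scale-mono {m} {n} m≤n with m≤n⇒m<n∨m≡n m≤n
  ... | inj₂ refl = ≤-refl
  scale-mono {m} {suc n} _ | inj₁ m<n = ≤-trans (scale-mono (s≤s⁻¹ m<n)) (scale-step n)

  -- 720720 is divisible by scale m for 1 ≤ m ≤ 13.
  units : ℕ → ℕ
  units m = 720720 / suc (pred (scale m))

  units-antitone : ∀ {m n} → m ≤ n → units n ≤ units m
  units-antitone m≤n = /-monoʳ-≤ 720720 (s≤s (pred-mono-≤ (scale-mono m≤n)))

  -- For an ascending list x ∷ xs: the units of all its elements, counting the last one twice.
  score : ℕ → List ℕ → ℕ
  score x []       = units x + units x
  score x (y ∷ ys) = units x + score y ys

  score-antitone : ∀ {x c} → c ≤ x → ∀ xs → score x xs ≤ score c xs
  score-antitone c≤x []       = +-mono-≤ (units-antitone c≤x) (units-antitone c≤x)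
  score-antitone c≤x (y ∷ ys) = +-monoˡ-≤ (score y ys) (units-antitone c≤x)

  -- The last entry is at most `b`, so its second copy in the score pays for `units b`. Thus the
  -- surplus term of the folding enters the search.
  score-≥ : ∀ {b x xs} → All (_≤ b) (x ∷ xs) → units b + sum (map units (x ∷ xs)) ≤ score x xs
  score-≥ {b} {x} {[]} (x≤b ∷ []) =
    ≤-trans (+-monoˡ-≤ _ (units-antitone x≤b)) (≤-reflexive (cong (units x +_) (+-identityʳ (units x))))
  score-≥ {b} {x} {y ∷ ys} (_ ∷ ≤b) = begin
    units b + (units x + sum (map units (y ∷ ys)))  ≡⟨ sym (+-assoc (units b) (units x) _) ⟩
    (units b + units x) + sum (map units (y ∷ ys))  ≡⟨ cong (_+ sum (map units (y ∷ ys))) (+-comm (units b) (units x)) ⟩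
    (units x + units b) + sum (map units (y ∷ ys))  ≡⟨ +-assoc (units x) (units b) _ ⟩
    units x + (units b + sum (map units (y ∷ ys)))  ≤⟨ +-monoʳ-≤ (units x) (score-≥ ≤b) ⟩
    units x + score y ys                            ∎
    where open ≤-Reasoning

  -- Exhaustive search for a dominating certificate

  dominates : List ℕ → List ℕ → Bool
  dominates []       ps       = true
  dominates (q ∷ qs) []       = false
  dominates (q ∷ qs) (p ∷ ps) = (p ≤ᵇ q) ∧ dominates qs ps

  -- Whatever `ps` covers is also covered by a `qs` that dominates it. Discarding can only make the
  -- search fail, so soundness asks merely that each survivor be `ps` or come from `ss`.
  addUndominated : List ℕ → List (List ℕ) → List (List ℕ)
  addUndominated ps ss = if any (λ qs → dominates qs ps) ss then ss else ps ∷ ss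

  addUndominated-∈ : ∀ {ps qs} ss → qs ∈ addUndominated ps ss → qs ≡ ps ⊎ qs ∈ ss
  addUndominated-∈ {ps} ss ∈a with any (λ qs → dominates qs ps) ss | ∈a
  ... | true  | ∈ss       = inj₂ ∈ss
  ... | false | here eq   = inj₁ eq
  ... | false | there ∈ss = inj₂ ∈ss

  advance : ℕ → List (List ℕ) → List (List ℕ)
  advance c []              = []
  advance c ([] ∷ ss)       = advance c ss
  advance c ((p ∷ ps) ∷ ss) = if c ≤ᵇ p then addUndominated ps (advance c ss) else advance c ss

  -- First entries from `c` up to, but excluding, this number leave the same certificates alive. The
  -- default 14 lies just past the admissible entries. The variant `⊓′` evaluates through the
  -- builtin `<ᵇ`.
  nextCritical : ℕ → List (List ℕ) → ℕ
  nextCritical c []             = 14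
  nextCritical c ([] ∷ ss)      = nextCritical c ss
  nextCritical c ((p ∷ _) ∷ ss) = if c ≤ᵇ p then suc p ⊓′ nextCritical c ss else nextCritical c ss

  ⊓′≤ˡ : ∀ m n → m ⊓′ n ≤ m
  ⊓′≤ˡ m n = subst (_≤ m) (⊓≡⊓′ m n) (m⊓n≤m m n)

  ⊓′≤ʳ : ∀ m n → m ⊓′ n ≤ n
  ⊓′≤ʳ m n = subst (_≤ n) (⊓≡⊓′ m n) (m⊓n≤n m n)

  advance-∈ : ∀ {c ss ps} → ps ∈ advance c ss → ∃ λ p → p ∷ ps ∈ ss × nextCritical c ss ≤ suc p
  advance-∈ {c} {[] ∷ ss} ∈a with advance-∈ {c} {ss} ∈a
  ... | p , ∈ss , le = p , there ∈ss , le
  advance-∈ {c} {(p ∷ ps) ∷ ss} ∈a with c ≤ᵇ p | ∈a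
  ... | false | ∈a' with q , ∈ss , le ← advance-∈ {c} {ss} ∈a' = q , there ∈ss , le
  ... | true  | ∈a' with addUndominated-∈ (advance c ss) ∈a'
  ...   | inj₁ refl = p , here refl , ⊓′≤ˡ (suc p) (nextCritical c ss)
  ...   | inj₂ ∈a'' with q , ∈ss , le ← advance-∈ {c} {ss} ∈a'' =
    q , there ∈ss , ≤-trans (⊓′≤ʳ (suc p) (nextCritical c ss)) le

  -- search k c ss t succeeds if every nonempty ascending list with entries in [c , 13]
  -- and score at least t is dominated by an element of ss; k is fuel.  The elements of ss
  -- are the remainders of the certificates not yet excluded.  As the score is antitone,
  -- the only first entries to be tried are c and those at which an element of ss drops out.
  mutual
    search : ℕ → ℕ → List (List ℕ) → ℕ → Bool
    search zero    c ss t = false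
    search (suc k) c ss t = (13 <ᵇ c) ∨ (descend k c (advance c ss) t ∧ search k (nextCritical c ss) ss t)

    -- Here `c` is the entry just placed and `ss` has survived it. An empty remainder covers every
    -- continuation; otherwise a list ending at `c`, whose score is `units c + units c`, must fall
    -- short of `t`, and longer lists owe the rest of the score.
    descend : ℕ → ℕ → List (List ℕ) → ℕ → Bool
    descend k c ss t = any null ss ∨ ((units c + units c <ᵇ t) ∧ search k c ss (t ∸ units c))

  Covers : List (List ℕ) → List ℕ → Set
  Covers ss xs = ∃ λ ps → ps ∈ ss × Dominates ps xs

  any-null : ∀ ss {xs} → T (any null ss) → Covers ss xs
  any-null ([] ∷ ss)      _  = [] , here refl , []
  any-null ((_ ∷ _) ∷ ss) ok with ps , ∈ss , dom ← any-null ss ok = ps , there ∈ss , dom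

  relax : ∀ {c x xs} → c ≤ x → Linked _≤_ (x ∷ xs) → Linked _≤_ (c ∷ xs)
  relax c≤x [-]            = [-]
  relax c≤x (x≤y ∷ sorted) = ≤-trans c≤x x≤y ∷ sorted

  mutual
    search-sound : ∀ k c ss t → T (search k c ss t) → ∀ {x xs} → c ≤ x → Linked _≤_ (x ∷ xs) →
                   All (_≤ 13) (x ∷ xs) → t ≤ score x xs → Covers ss (x ∷ xs)
    search-sound (suc k) c ss t ok {x} {xs} c≤x sorted bounded t≤ with to T-∨ ok
    ... | inj₁ 13<c = contradiction (<-≤-trans (<ᵇ⇒< 13 c 13<c) c≤x) (≤⇒≯ (All.head bounded))
    ... | inj₂ ok' with to T-∧ ok' | nextCritical c ss ≤? x
    ...   | _ , okNext | yes next≤x = search-sound k (nextCritical c ss) ss t okNext next≤x sorted bounded t≤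
    -- Lowering `x` to `c` keeps the list ascending and can only raise the score. The certificate
    -- found still admits `x`, because `x < nextCritical c ss ≤ suc p`.
    ...   | okHere , _ | no  next≰x
      with ps , ∈a , dom ← descend-sound k c (advance c ss) t okHere (relax c≤x sorted) (All.tail bounded)
             (≤-trans t≤ (score-antitone c≤x xs))
      with p , ∈ss , next≤p ← advance-∈ {c} {ss} ∈a =
      p ∷ ps , ∈ss , s≤s⁻¹ (<-≤-trans (≰⇒> next≰x) next≤p) ∷ dom

    descend-sound : ∀ k c ss t → T (descend k c ss t) → ∀ {xs} → Linked _≤_ (c ∷ xs) →
                    All (_≤ 13) xs → t ≤ score c xs → Covers ss xs
    descend-sound k c ss t ok {xs} sorted bounded t≤ with to T-∨ ok
    ... | inj₁ ok' = any-null ss ok'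
    ... | inj₂ ok' with to (T-∧ {units c + units c <ᵇ t}) ok'
    descend-sound k c ss t ok {[]} sorted bounded t≤ | inj₂ _ | 2u<t , _ = contradiction (<ᵇ⇒< _ t 2u<t) (≤⇒≯ t≤)
    descend-sound k c ss t ok {y ∷ ys} (c≤y ∷ sorted) bounded t≤ | inj₂ _ | _ , okRest =
      search-sound k c ss (t ∸ units c) okRest c≤y sorted bounded (m≤n+o⇒m∸n≤o t (units c) t≤)

  -- Generic in the encoding, because hexDigits explodes when unfolded on open terms.
  certified-search : ∀ {C : Set} (periods word : C → List ℕ) k cs t →
    all (λ c → realizes (periods c) (word c)) cs ≡ true → search k 1 (map periods cs) t ≡ true →
    ∀ {x xs} → 0 < x → Linked _≤_ (x ∷ xs) → All (_≤ 13) (x ∷ xs) → t ≤ score x xs → SchedulableList (x ∷ xs)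
  certified-search periods word k cs t valid found 0<x sorted bounded t≤
    with ps , ∈ps , dom ← search-sound k 1 (map periods cs) t (from T-≡ found) 0<x sorted bounded t≤
    with c , ∈cs , refl ← ∈-map⁻ periods ∈ps =
    schedulable-dominates dom (realizes-sound (periods c) (word c) (All.lookup (all⁺ _ cs (from T-≡ valid)) ∈cs))

  -- The fuel 500 exceeds the number of digits of every literal below.
  hexDigits : ℕ → List ℕ
  hexDigits n = go 500 n []
    where
    go : ℕ → ℕ → List ℕ → List ℕ
    go zero    n ds = ds
    go (suc k) n ds = if n <ᵇ 16 then n ∷ ds else go k (n / 16) (n % 16 ∷ ds)

  -- Each pair lists the periods p₀ ≤ p₁ ≤ … of an instance and one period of a cyclic
  -- schedule for it, as hexadecimal digits; the digit i in a schedule stands for the job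
  -- with period pᵢ.  The descending order matters for the speed of the search: it lets
  -- addUndominated discard most of the redundant certificates.
  certificates : List (ℕ × ℕ)
  certificates =
    (0xddddddddddddd , 0x123456789abc0) ∷
    (0xbbbbbbccdddd , 0x607182394a5b0617238495a0b1623748590a1b2364758091a23b4657081923a4b5) ∷
    (0xbbbbbbbbbbb , 0x123456789a0) ∷
    (0xaaaadddddddd , 0x4506718923ab04516723890ab14523670891ab23) ∷
    (0xaaaaacccccc , 0x5061728394a05162738490a15263748091a25364708192a35460718293a4) ∷
    (0xaaaaaaadddd , 0x7128349560a127348560912a347560812934a560) ∷
    (0xaaaaaaaaaa , 0x1234567890) ∷
    (0x99ccccdddddd , 0x604782195a03b641728059a31b4602785193a04b621758039a41b2605783194a02b651738049a21b5603784192a05b631748029a51b3) ∷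
    (0x999ddddddddd , 0x3405671289a0b3412567089a12b) ∷
    (0x999abbbbcdd , 0x3941586270a314952607813a42506971382405a617923048516a720) ∷
    (0x9999ccccddd , 0x806194237a051862349071a5236804197235a061842379051a6234807195236a041872359061a4237805196234a071852369041a7235) ∷
    (0x99999bbbbb , 0x516273840915263740819253640718293540617283940) ∷
    (0x9999999ddd , 0x712384560912374560812394560) ∷
    (0x999999999 , 0x123456780) ∷
    (0x8aaaaacccdd , 0x1026394750182a364057192830465a172038495610273a485016293740581a263047591820364a571028394650172a384056192730485a162037495810263a475018293640571a283046591720384a561027394850162a374058192630475a182036495710283a465017293840561a273048591620374a58) ∷
    (0x88aaaaaccc , 0x720384159602731485069213740586129304751682039415760283149506721384059612730485169203741586029314750682139405761283049516) ∷
    (0x8899adddddd , 0x526047813920a541637082914a503621784093a1) ∷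
    (0x888cccddddd , 0x36074182590a3162470851923a064172580931a246075182390a4162570831924a065172380941a256073182490a5162370841925a063172480951a2) ∷
    (0x888aaaaadd , 0x30415862703149526071384250617932405168723041596270314852607139425061783240516972) ∷
    (0x8888ddddddd , 0x4560178239a014562378019a23) ∷
    (0x8888cccccc , 0x401562378019423560178239) ∷
    (0x8888aaaddd , 0x270438152609341725063814290536172408351629043715260834192506371428053619240735162804391526073418250639142705361824093516) ∷
    (0x8888aaaaa , 0x4051627380415263708142536071824350617283) ∷
    (0x88888ddddd , 0x5162374081923540617238409152364071823940) ∷
    (0x888888ccc , 0x601273458012634570128345) ∷
    (0x8888888dd , 0x1273456012834560) ∷
    (0x88888888 , 0x12345670) ∷
    (0x7bbbdddddddd , 0x40516782093ab41506278390a1b4520637891a0b2453607189a20b3456170829a3b04156720839ab140526738091ab42053678190a2b43506178920a3b4516072893a0b1456207389a1b04256370819ab204356718092ab3) ∷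
    (0x7bbbbbbbbdd , 0x9123045a67801239450678a12304596780123a450678) ∷
    (0x7888bbbbdd , 0x1482530617924035186207341950263871402539610782435016927304158260371942053618702439516027384105926370) ∷
    (0x788899dddd , 0x6172340851923640715238049162375041823905) ∷
    (0x78888999c , 0x512360748123506471238504612370548123607451238604712350648123705461238704) ∷
    (0x7799bbbbcc , 0x248156039217408531269074138205619730) ∷
    (0x7799aaacdd , 0x284013596201473850126943015728601349520167384012596301472850136942015738601249530167) ∷
    (0x7799999bb , 0x23047516820341576028314506721384056127304851620374158602314750682134057612830451672038415602731485062137405861) ∷
    (0x778aaacccc , 0x623701489250631742085193604217580391246057132894015) ∷
    (0x7788bbbcdd , 0x8204913570621843095126703481250963172048513690271435086129304715268031942705136) ∷
    (0x7788899ad , 0x253640172835014627301548260137452016384701) ∷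
    (0x777aaccccd , 0x506137280491523067142809315260471823905142670318294051623708149250316724081932506147280391524067132809415260371824905132670418293051624708139250416723081942) ∷
    (0x777aaadddd , 0x630124785012396401257830124965012378401259) ∷
    (0x7777dddddd , 0x45012367801239) ∷
    (0x7777bbbbb , 0x4015236701842350167238) ∷
    (0x77779999 , 0x4152630714253061724305162730) ∷
    (0x77777dddd , 0x56012347801234) ∷
    (0x7777777 , 0x1234560) ∷
    (0x6cccccccccc , 0x10234560789a) ∷
    (0x6aaaaaaadd , 0x1203485607129340568712034956071283405697) ∷
    (0x69bbbbccddd , 0x826390147a502861309475a0126830497150a263801479502a6130847590126a304871509263a0147850296130a475801269304a7150) ∷
    (0x69999ccddd , 0x710285340916270345810296340715280346910275340816290345710286340915270346810295340716280345910276340815290346) ∷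
    (0x6999999cc , 0x712034856012734056812034756012834056) ∷
    (0x688aabbbcd , 0x58103627940518236074195023861470259310642780135924607183250496170328541069237018542063197024) ∷
    (0x68899aaaa , 0x534061728034516072834051627034815062734081526034718052634071825034617082) ∷
    (0x67799bbbb , 0x135026714032851064237018524031672084) ∷
    (0x67778bbdd , 0x751240386120435710263480125370412630851240376120435810263470125380412630) ∷
    (0x6777888c , 0x142530617240351620437150263410527360) ∷
    (0x66ddddddddd , 0x201345670189a) ∷
    (0x66bbbbbbdd , 0x203415860712934051687021349506178203415960712834051697021348506179) ∷
    (0x66aaaaacc , 0x720314850612730415860213740516820314750612830415760213840516) ∷
    (0x669999ddd , 0x620371450821360451720381450621370451820361450721380451) ∷
    (0x66999999 , 0x203415607213405617) ∷
    (0x6688ccccc , 0x402156307128403156207138) ∷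
    (0x668888cc , 0x620314750213640512730415) ∷
    (0x666aaaaa , 0x304152607132405162703142506172) ∷
    (0x6666999 , 0x401523601423501623) ∷
    (0x5bbbbbbbbb , 0x12034560789) ∷
    (0x5aadddddddd , 0x134052670819a0324506178092a304156072890a) ∷
    (0x58bccdddddd , 0x563107284091a503627014890a531062740819a035260147809a31052640718903a2501467089310a254061780392a0145607831092a40516703829014a506731082940a156037280149a0) ∷
    (0x5888bbbbb , 0x451062783014520637810245306178203) ∷
    (0x5888aaccc , 0x410625370148203651072438015620374108253601472038510624370158203641072538014620375108243601572038) ∷
    (0x588899add , 0x610427503168024530716204385012670345108263041750236801452073610428503167024530816204375012680345107263041850236701452083) ∷
    (0x588888aa , 0x16203475102634051720346510273405) ∷
    (0x5788aaadd , 0x742105836012470351602843105726013480251603) ∷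
    (0x57888bbdd , 0x2573041620835140276310458201364702513804621037540126830415207361402853104672013548026137045210386401) ∷
    (0x577bbbbbb , 0x3014526071830245160728) ∷
    (0x5778aaccd , 0x8301642073150824610375201483026510732408156203741025) ∷
    (0x57789bccc , 0x6350142703816240531702846013520741802) ∷
    (0x57788ccdd , 0x7153026410832701546023180472530164208317025460132804) ∷
    (0x5777bbbdd , 0x47015263081420357610234801526307142035861023) ∷
    (0x56abbbdddd , 0x607314802951063740182590136407125809314602751083940162570138409125) ∷
    (0x569cccccdd , 0x801934201567081239041560271803941205671083249015670213804915206713084219056710234801956201734081259061730241805961207341085269017340215806917203415086219073410256801973201456081279031450261807931204561087239014560217803914205617083219045610273801945201673081249051670231804951206731084259016730214805916207314085219067310245801967201345081269071340251806971203451086279013450216807913204516087219034510267) ∷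
    (0x568bdddddd , 0x451206371082940153602178094120536107289014350216708912043510627801934021560781209341052670183902145067120839104256017380219405612073810924501637021890) ∷
    (0x56777add , 0x621304752013460215307412036540123704152063140275301426031540721304652013470215306412037540123604152073140265301427031540) ∷
    (0x55bbbbbbb , 0x20134501678) ∷
    (0x55aaaaaa , 0x2013450167) ∷
    (0x5599999b , 0x2031475061230415760213405167203145061273041560213740516) ∷
    (0x5588888 , 0x2034156021340561) ∷
    (0x556aaadd , 0x6032140751203614025170321406512037140251) ∷
    (0x55689bbc , 0x501427031620415307126401352017460123) ∷
    (0x5566dddd , 0x40521360712304152036170231) ∷
    (0x555ccccc , 0x3142051620713204152061720) ∷
    (0x555aaddd , 0x351204612037120451203612047120) ∷
    (0x555aaaa , 0x3012450126) ∷
    (0x555777 , 0x314205132041520) ∷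
    (0x5555ddd , 0x142301523016230) ∷
    (0x55555 , 0x12340) ∷
    (0x4dddddddddd , 0x102345067809a) ∷
    (0x4aaaaaccc , 0x610273048501620374058102630475018203640571028304650172038405) ∷
    (0x499ccccddd , 0x570318602490517302680419502370618402590317602480519302670418502390617402580319602470518302690417502380619402) ∷
    (0x499999ddd , 0x162307450182306450172308450) ∷
    (0x48abbddddd , 0x536047108290351064702810935046107280391054602710839045106270381094502610738049105260371084902510637048109250361074802910) ∷
    (0x488aaaaa , 0x3140526071304250617032405160723041506270) ∷
    (0x48888ccc , 0x501260347012503460127034) ∷
    (0x4888888 , 0x10234056) ∷
    (0x4777799 , 0x1520364102530416203541026304) ∷
    (0x46ccccccc , 0x201340561078) ∷
    (0x468ccccdd , 0x730124058106230174052106830124057106230184052106) ∷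
    (0x46788ddd , 0x5301460273104520136047201350421063701240531026407310254013602741035201460372014503210647012305410263074102) ∷
    (0x466dddddd , 0x3012405612078) ∷
    (0x4669999 , 0x130245106230145206) ∷
    (0x4666ccc , 0x410253016203) ∷
    (0x46668dd , 0x152034102630142035102430162034102530142036102430) ∷
    (0x4599aabb , 0x401526013704120561037402150631072401536012704130561027403150621073) ∷
    (0x4599aaac , 0x720134051602730415062103740512063104750123061405720136041502730614052103760412053106740123051604720135061402730516042103750612043105760123041506) ∷
    (0x458bbdddd , 0x502610738012405160321074801520613047108250163041702810536012407180321054601720813045106270183041) ∷
    (0x45888aa , 0x52103640125031406210354012603140) ∷
    (0x455888 , 0x3014205130241052) ∷
    (0x44ddddddd , 0x2013450167018) ∷
    (0x44aaaaa , 0x20314051602130415061) ∷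
    (0x448cccdd , 0x163012401750123016401250173012401650123017401250) ∷
    (0x448888 , 0x20134015) ∷
    (0x447adddd , 0x304120516032107410251306120714032105610271) ∷
    (0x446cccc , 0x302140512061) ∷
    (0x446aaad , 0x302140615021304120516031204150213061402150312041605120314021506130214051203160412051) ∷
    (0x4466cc , 0x402130512031) ∷
    (0x44488 , 0x30124012) ∷
    (0x4444 , 0x1230) ∷
    (0x3ddddddddd , 0x1023045607809) ∷
    (0x3cccccccc , 0x102304506708) ∷
    (0x3aaaaaaa , 0x1023405607) ∷
    (0x399dddddd , 0x310450260710830240510670280) ∷
    (0x3999cccc , 0x401502603701402503601702403501602703) ∷
    (0x39999ddd , 0x510260340710250340610270340) ∷
    (0x388888a , 0x61023045016203405102630450120364051023046501203405) ∷
    (0x37cccccdd , 0x702301405806102307405106802301405706102308405106) ∷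
    (0x37788aa , 0x53012064031052046301205403106204) ∷
    (0x377888d , 0x6301402503104205) ∷
    (0x377777 , 0x1203405) ∷
    (0x36cccccc , 0x201304501607) ∷
    (0x3699dddd , 0x240130560210730410250630170) ∷
    (0x36999cc , 0x520130640120530140620130540120630140) ∷
    (0x366999 , 0x301402501302401502) ∷
    (0x35bbbbdd , 0x61023017405106201304701502610340175021063014057012036104501720310640150270130461052017304106501203701405) ∷
    (0x355dddd , 0x31024015026103201402501620) ∷
    (0x355aaa , 0x3102401520) ∷
    (0x35557 , 0x410230142031024301203) ∷
    (0x3499ddd , 0x410250130610240130510260130) ∷
    (0x344ddd , 0x3102410250120) ∷
    (0x33ddddd , 0x2013014015016) ∷
    (0x33cccc , 0x201301401501) ∷
    (0x33999 , 0x201301401) ∷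
    (0x3366 , 0x201301) ∷
    (0x333 , 0x120) ∷
    (0x2ddddddd , 0x1020304506070) ∷
    (0x2aaaddd , 0x104020503010602040301050206030) ∷
    (0x2aaaaa , 0x1020304050) ∷
    (0x28cccdd , 0x502010306040102050301040602010305040102060301040) ∷
    (0x288ccc , 0x301040205010302040105020) ∷
    (0x28888 , 0x10203040) ∷
    (0x266ddd , 0x3040102050102) ∷
    (0x266cc , 0x301020401020) ∷
    (0x2666 , 0x102030) ∷
    (0x24dddd , 0x2013040105010) ∷
    (0x24ccc , 0x201030104010) ∷
    (0x248dd , 0x1030102010401020) ∷
    (0x2488 , 0x20103010) ∷
    (0x244 , 0x1020) ∷
    (0x22 , 0x10) ∷
    (0x1 , 0x0) ∷
    []

  periods word : ℕ × ℕ → List ℕ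
  periods = hexDigits ∘ proj₁
  word    = hexDigits ∘ proj₂

  certificates-valid : all (λ c → realizes (periods c) (word c)) certificates ≡ true
  certificates-valid = refl

  -- 468468 = 13/20 · 720720
  search-succeeds : search 100 1 (map periods certificates) 468468 ≡ true
  search-succeeds = refl

  -- abstract, lest the search be run again at each use
  abstract
    score⇒schedulable : ∀ {x xs} → 0 < x → Linked _≤_ (x ∷ xs) → All (_≤ 13) (x ∷ xs) →
                        468468 ≤ score x xs → SchedulableList (x ∷ xs)
    score⇒schedulable = certified-search periods word 100 certificates 468468 certificates-valid search-succeeds

-- Eliminating the periods above 13

module Folding where

  open Schedules
  open Search
  open import Data.Integer as ℤ using (+_)
  import Data.Integer.Properties as ℤ
  open import Data.List using (List; []; _∷_; map; foldr; length; tabulate)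
  open import Data.List.Relation.Binary.Permutation.Propositional using (_↭_; ↭⇒↭ₛ; ↭-sym)
  open import Data.List.Relation.Binary.Permutation.Propositional.Properties using (All-resp-↭; map⁺; ↭-length)
  open import Data.List.Relation.Binary.Permutation.Setoid.Properties using (foldr-commMonoid)
  open import Data.List.Relation.Unary.All as All using (All; []; _∷_)
  open import Data.List.Relation.Unary.All.Properties using (tabulate⁺)
  open import Data.List.Relation.Unary.Linked using (Linked; []; [-]; _∷_)
  open import Data.Fin using (Fin; zero; suc)
  open import Data.Nat as ℕ using (ℕ; zero; suc; z≤n; s≤s; z<s; ⌈_/2⌉)
  open import Data.Nat.Coprimality as Coprime using (1-coprimeTo)
  import Data.Nat.ListAction as ℕ
  import Data.Nat.Properties as ℕ
  open import Data.Nat.Tactic.RingSolver using (solve-∀)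
  open import Data.Product using (_,_)
  open import Data.Rational using (ℚ; mkℚ; _/_; 0ℚ; ½; _+_; _*_; _≤_; *≤*; toℚᵘ)
  open import Data.Rational.Properties
  open import Data.Rational.Unnormalised as ℚᵘ using (mkℚᵘ; *≡*)
  import Data.Rational.Unnormalised.Properties as ℚᵘ
  open import Function using (_∘_)
  open import Relation.Binary.Properties.DecTotalOrder ℕ.≤-decTotalOrder using (≥-decTotalOrder)
  open import Relation.Binary.PropositionalEquality using (_≡_; refl; sym; trans; cong; cong₂; subst; subst₂; module ≡-Reasoning)
  open import Relation.Nullary using (¬_; yes; no; contradiction)
  open import Relation.Nullary.Decidable using (from-yes; from-no)
  import Data.List.Sort ℕ.≤-decTotalOrder as Ascending
  import Data.List.Sort ≥-decTotalOrder as Descending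

  -- Built with `mkℚ` so that numerator and denominator are available by definition, without
  -- normalisation by a gcd.
  fromℕ : ℕ → ℚ
  fromℕ n = mkℚ (+ n) 0 (Coprime.sym (1-coprimeTo n))

  fromℕ-+ : ∀ m n → fromℕ (m ℕ.+ n) ≡ fromℕ m + fromℕ n
  fromℕ-+ m n = trans (sym (↥p/↧p≡p (fromℕ (m ℕ.+ n))))
    (cong (_/ 1) (cong₂ ℤ._+_ (sym (ℤ.*-identityʳ (+ m))) (sym (ℤ.*-identityʳ (+ n)))))

  fromℕ-≤ : ∀ {m n} → fromℕ m ≤ fromℕ n → m ℕ.≤ n
  fromℕ-≤ {m} {n} (*≤* le) = ℤ.drop‿+≤+ (subst₂ ℤ._≤_ (ℤ.*-identityʳ (+ m)) (ℤ.*-identityʳ (+ n)) le)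

  recip-antitone : ∀ {m n} → 0 ℕ.< m → m ℕ.≤ n → recip n ≤ recip m
  recip-antitone {suc m} {suc n} _ m≤n = toℚᵘ-cancel-≤ (ℚᵘ.≤-respˡ-≃ (ℚᵘ.≃-sym (toℚᵘ-fromℚᵘ (mkℚᵘ (+ 1) n)))
    (ℚᵘ.≤-respʳ-≃ (ℚᵘ.≃-sym (toℚᵘ-fromℚᵘ (mkℚᵘ (+ 1) m))) (ℚᵘ.*≤* (ℤ.*-monoˡ-≤-nonNeg (+ 1) (ℤ.+≤+ m≤n)))))

  recip-double : ∀ m → recip (m ℕ.+ m) ≡ ½ * recip m
  recip-double zero    = refl
  recip-double (suc m) = toℚᵘ-injective (begin
    toℚᵘ (recip (suc m ℕ.+ suc m))          ≈⟨ toℚᵘ-fromℚᵘ (mkℚᵘ (+ 1) (m ℕ.+ suc m)) ⟩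
    mkℚᵘ (+ 1) (m ℕ.+ suc m)                ≈⟨ *≡* (cong +_ eq) ⟩
    toℚᵘ ½ ℚᵘ.* mkℚᵘ (+ 1) m                ≈⟨ ℚᵘ.*-congˡ {toℚᵘ ½} (toℚᵘ-fromℚᵘ (mkℚᵘ (+ 1) m)) ⟨
    toℚᵘ ½ ℚᵘ.* toℚᵘ (recip (suc m))        ≈⟨ toℚᵘ-homo-* ½ (recip (suc m)) ⟨
    toℚᵘ (½ * recip (suc m))                ∎)
    where
    open ℚᵘ.≃-Reasoning
    eq : 1 ℕ.* (2 ℕ.* suc m) ≡ 1 ℕ.* (suc m ℕ.+ suc m)
    eq = cong (1 ℕ.*_) (cong (suc m ℕ.+_) (ℕ.+-identityʳ (suc m)))

  fromℕ-*-/ : ∀ {m o} q n k → m ≡ q ℕ.* suc k → q ℕ.* n ≡ o → fromℕ m * (+ n / suc k) ≡ fromℕ o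
  fromℕ-*-/ q n k refl refl = toℚᵘ-injective (begin
    toℚᵘ (fromℕ (q ℕ.* suc k) * (+ n / suc k))            ≈⟨ toℚᵘ-homo-* (fromℕ (q ℕ.* suc k)) (+ n / suc k) ⟩
    mkℚᵘ (+ (q ℕ.* suc k)) 0 ℚᵘ.* toℚᵘ (+ n / suc k)      ≈⟨ ℚᵘ.*-congˡ {mkℚᵘ (+ (q ℕ.* suc k)) 0} (toℚᵘ-fromℚᵘ (mkℚᵘ (+ n) k)) ⟩
    mkℚᵘ (+ (q ℕ.* suc k)) 0 ℚᵘ.* mkℚᵘ (+ n) k            ≈⟨ *≡* eq ⟩
    mkℚᵘ (+ (q ℕ.* n)) 0                                  ∎)
    where
    open ℚᵘ.≃-Reasoning
    swap : ∀ q n k → q ℕ.* k ℕ.* n ℕ.* 1 ≡ q ℕ.* n ℕ.* (1 ℕ.* k)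
    swap = solve-∀
    eq : (+ (q ℕ.* suc k) ℤ.* + n) ℤ.* + 1 ≡ + (q ℕ.* n) ℤ.* + (1 ℕ.* suc k)
    eq = trans (cong (ℤ._* + 1) (sym (ℤ.pos-* (q ℕ.* suc k) n)))
      (trans (sym (ℤ.pos-* (q ℕ.* suc k ℕ.* n) 1)) (trans (cong +_ (swap q n (suc k))) (ℤ.pos-* (q ℕ.* n) (1 ℕ.* suc k))))

  -- Half of the density that `scale` assigns, whence the threshold 13/20 in place of 13/10.
  weight : ℕ → ℚ
  weight m = recip (scale m)

  totalWeight : List ℕ → ℚ
  totalWeight xs = foldr _+_ 0ℚ (map weight xs)

  totalWeight-↭ : ∀ {xs ys} → xs ↭ ys → totalWeight xs ≡ totalWeight ys
  totalWeight-↭ p = foldr-commMonoid ≡-setoid +-0-isCommutativeMonoid (↭⇒↭ₛ (map⁺ weight p))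

  units-exact : ∀ {m} → m ℕ.< 14 → units m ℕ.* suc (ℕ.pred (scale m)) ≡ 720720
  units-exact = from-yes (ℕ.allUpTo? (λ m → units m ℕ.* suc (ℕ.pred (scale m)) ℕ.≟ 720720) 14)

  scale-positive : ∀ {m} → 0 ℕ.< m → 0 ℕ.< scale m
  scale-positive 0<m = ℕ.≤-trans (s≤s z≤n) (scale-mono 0<m)

  weight-scaled : ∀ m → m ℕ.≤ 13 → 0 ℕ.< m → fromℕ 720720 * weight m ≡ fromℕ (units m)
  weight-scaled m m≤13 0<m = trans
    (cong (λ k → fromℕ 720720 * recip k) (sym (ℕ.suc-pred (scale m) {{ℕ.>-nonZero (scale-positive 0<m)}})))
    (fromℕ-*-/ (units m) 1 (ℕ.pred (scale m)) (sym (units-exact (s≤s m≤13))) (ℕ.*-identityʳ (units m)))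

  totalWeight-scaled : ∀ {xs} → All (ℕ._≤ 13) xs → All (0 ℕ.<_) xs →
                       fromℕ 720720 * totalWeight xs ≡ fromℕ (ℕ.sum (map units xs))
  totalWeight-scaled [] [] = refl
  totalWeight-scaled {x ∷ xs} (x≤ ∷ xs≤) (x> ∷ xs>) = begin
    fromℕ 720720 * (weight x + totalWeight xs)                ≡⟨ *-distribˡ-+ (fromℕ 720720) (weight x) (totalWeight xs) ⟩
    fromℕ 720720 * weight x + fromℕ 720720 * totalWeight xs   ≡⟨ cong₂ _+_ (weight-scaled x x≤ x>) (totalWeight-scaled xs≤ xs>) ⟩
    fromℕ (units x) + fromℕ (ℕ.sum (map units xs))            ≡⟨ sym (fromℕ-+ (units x) _) ⟩
    fromℕ (units x ℕ.+ ℕ.sum (map units xs))                  ∎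
    where open ≡-Reasoning

  weight-antitone : ∀ {m n} → 0 ℕ.< m → m ℕ.≤ n → weight n ≤ weight m
  weight-antitone 0<m m≤n = recip-antitone (scale-positive 0<m) (scale-mono m≤n)

  scale≤2m : ∀ m → scale m ℕ.≤ m ℕ.+ m
  scale≤2m 0 = ℕ.≤ᵇ⇒≤ _ _ _
  scale≤2m 1 = ℕ.≤ᵇ⇒≤ _ _ _
  scale≤2m 2 = ℕ.≤ᵇ⇒≤ _ _ _
  scale≤2m 3 = ℕ.≤ᵇ⇒≤ _ _ _
  scale≤2m 4 = ℕ.≤ᵇ⇒≤ _ _ _
  scale≤2m 5 = ℕ.≤ᵇ⇒≤ _ _ _
  scale≤2m 6 = ℕ.≤ᵇ⇒≤ _ _ _
  scale≤2m 7 = ℕ.≤ᵇ⇒≤ _ _ _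
  scale≤2m (suc m@(suc (suc (suc (suc (suc (suc (suc _)))))))) = ℕ.+-mono-≤ (ℕ.n≤1+n m) (ℕ.n≤1+n m)

  -- Weights only overstate densities, so the hypothesis survives the change; the price is that the
  -- finite search must succeed with the inflated numbers.
  ½-recip≤weight : ∀ {m} → 0 ℕ.< m → ½ * recip m ≤ weight m
  ½-recip≤weight {m} 0<m = ≤-trans (≤-reflexive (sym (recip-double m))) (recip-antitone (scale-positive 0<m) (scale≤2m m))

  -- The case `k = 0` is `13 + 13 ≤ 26`, an equality, so 13 is the largest value possible for
  -- `scale 7`. Beyond it both sides follow the generic formula, and the claim is
  -- `2 (⌈ b /2⌉ - 1) ≤ b - 1` for `b = 14 + k`.
  scale-half : ∀ k → scale (7 ℕ.+ ⌈ k /2⌉) ℕ.+ scale (7 ℕ.+ ⌈ k /2⌉) ℕ.≤ scale (14 ℕ.+ k)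
  scale-half zero    = ℕ.≤-refl
  scale-half (suc k) = ℕ.+-mono-≤ bound bound
    where
    open ℕ.≤-Reasoning
    h = ℕ.⌊ k /2⌋
    double : ∀ n → (7 ℕ.+ n) ℕ.+ (7 ℕ.+ n) ≡ 14 ℕ.+ (n ℕ.+ n)
    double = solve-∀
    bound : (7 ℕ.+ h) ℕ.+ (7 ℕ.+ h) ℕ.≤ 14 ℕ.+ k
    bound = begin
      (7 ℕ.+ h) ℕ.+ (7 ℕ.+ h)   ≡⟨ double h ⟩
      14 ℕ.+ (h ℕ.+ h)          ≤⟨ ℕ.+-monoʳ-≤ 14 (ℕ.≤-trans (ℕ.+-monoʳ-≤ h (ℕ.⌊n/2⌋≤⌈n/2⌉ k)) (ℕ.≤-reflexive (ℕ.⌊n/2⌋+⌈n/2⌉≡n k))) ⟩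
      14 ℕ.+ k                  ∎

  ≤½⇒double≤ : ∀ {p q} → p ≤ ½ * q → p + p ≤ q
  ≤½⇒double≤ {p} {q} p≤½q = begin
    p + p           ≤⟨ +-mono-≤ p≤½q p≤½q ⟩
    ½ * q + ½ * q   ≡⟨ sym (*-distribʳ-+ q ½ ½) ⟩
    (½ + ½) * q     ≡⟨ *-identityˡ q ⟩
    q               ∎
    where open ≤-Reasoning

  recip-half : ∀ {m n} → 0 ℕ.< m → m ℕ.+ m ℕ.≤ n → recip n + recip n ≤ recip m
  recip-half {m} {n} 0<m 2m≤n = ≤½⇒double≤
    (≤-trans (recip-antitone (ℕ.≤-trans 0<m (ℕ.m≤m+n m m)) 2m≤n) (≤-reflexive (recip-double m)))

  weight-half : ∀ {b} → 14 ℕ.≤ b → weight b + weight b ≤ weight ⌈ b /2⌉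
  weight-half {b} 14≤b = recip-half (scale-positive (ℕ.⌈n/2⌉-mono (ℕ.≤-trans (s≤s z≤n) 14≤b)))
    (subst (λ n → scale ⌈ n /2⌉ ℕ.+ scale ⌈ n /2⌉ ℕ.≤ scale n) (ℕ.m+[n∸m]≡n 14≤b) (scale-half (b ℕ.∸ 14)))

  cons-bounded : ∀ {c xs} → All (c ℕ.≥_) xs → Linked ℕ._≥_ xs → Linked ℕ._≥_ (c ∷ xs)
  cons-bounded []        []     = [-]
  cons-bounded (c≥x ∷ _) sorted = c≥x ∷ sorted

  linked⇒all : ∀ {c xs} → Linked ℕ._≥_ (c ∷ xs) → All (c ℕ.≥_) xs
  linked⇒all [-]            = []
  linked⇒all (c≥x ∷ sorted) = c≥x ∷ All.map (λ x≥y → ℕ.≤-trans x≥y c≥x) (linked⇒all sorted)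

  scaled-≤ : ∀ {m o t} q n k → m ≡ q ℕ.* suc k → q ℕ.* n ≡ o → + n / suc k ≤ t → fromℕ o ≤ fromℕ m * t
  scaled-≤ {m} {t = t} q n k m≡ ≡o le =
    subst (_≤ fromℕ m * t) (fromℕ-*-/ q n k m≡ ≡o) (*-monoˡ-≤-nonNeg (fromℕ m) le)

  -- No weight exceeds `weight 1`, which is 1/2.
  totalWeight-[] : ∀ {a} → 0 ℕ.< a → ¬ (+ 13 / 20 ≤ weight a + totalWeight [])
  totalWeight-[] 0<a heavy = contradiction
    (≤-trans heavy (+-monoˡ-≤ 0ℚ (weight-antitone {1} z<s 0<a))) (from-no (+ 13 / 20 ≤? weight 1 + 0ℚ))

  ascending : ∀ {b xs} → b ℕ.≤ 13 → Linked ℕ._≤_ xs → All (ℕ._≤ b) xs → All (0 ℕ.<_) (b ∷ xs) →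
              + 13 / 20 ≤ weight b + totalWeight xs → SchedulableList xs
  ascending {b} {[]}     _    _      _  (0<b ∷ _) heavy = contradiction heavy (totalWeight-[] 0<b)
  ascending {b} {x ∷ xs} b≤13 sorted ≤b pos@(_ ∷ 0<x ∷ _) heavy =
    score⇒schedulable 0<x sorted ≤13 (ℕ.≤-trans (fromℕ-≤ scaled) (score-≥ ≤b))
    where
    ≤13 : All (ℕ._≤ 13) (x ∷ xs)
    ≤13 = All.map (λ y≤b → ℕ.≤-trans y≤b b≤13) ≤b
    scaled : fromℕ 468468 ≤ fromℕ (units b ℕ.+ ℕ.sum (map units (x ∷ xs)))
    scaled = subst (fromℕ 468468 ≤_) (totalWeight-scaled (b≤13 ∷ ≤13) pos)
      -- 36036 is 720720 / 20, and 13 times it is 468468.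
      (scaled-≤ {720720} {468468} 36036 13 19 refl refl heavy)

  bounded : ∀ {b xs} → b ℕ.≤ 13 → All (ℕ._≤ b) xs → All (0 ℕ.<_) (b ∷ xs) →
            + 13 / 20 ≤ weight b + totalWeight xs → SchedulableList xs
  bounded {b} {xs} b≤13 ≤b (0<b ∷ 0<xs) heavy = schedulable-↭ sorted
    (ascending b≤13 (Ascending.sort-↗ xs) (All-resp-↭ (↭-sym sorted) ≤b) (0<b ∷ All-resp-↭ (↭-sym sorted) 0<xs)
      (≤-trans heavy (≤-reflexive (cong (_+_ (weight b)) (sym (totalWeight-↭ sorted))))))
    where
    sorted : Ascending.sort xs ↭ xs
    sorted = Ascending.sort-↭ xs

  -- The sum weight a + totalWeight xs, where a bounds xs, does not decrease when the two
  -- longest periods are merged, nor when the longest is dropped because it exceeds twice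
  -- the next one.
  fold : ∀ n a xs → length xs ℕ.≤ n → Linked ℕ._≥_ (a ∷ xs) → All (0 ℕ.<_) (a ∷ xs) →
         + 13 / 20 ≤ weight a + totalWeight xs → SchedulableList xs
  fold n a [] _ _ (0<a ∷ _) heavy = contradiction heavy (totalWeight-[] 0<a)
  fold n a (b ∷ xs) len (a≥b ∷ sorted) (0<a ∷ 0<b ∷ 0<xs) heavy with b ℕ.≤? 13
  -- The bound `a` may exceed 13, where `units` need not be exact, so `b` takes its place.
  ... | yes b≤13 = bounded b≤13 (ℕ.≤-refl ∷ linked⇒all sorted) (0<b ∷ 0<b ∷ 0<xs)
    (≤-trans heavy (+-monoˡ-≤ (totalWeight (b ∷ xs)) (weight-antitone 0<b a≥b)))
  -- A single job above 13 is too light: 1/2 + 1/26 < 13/20.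
  fold n a (b ∷ []) len (a≥b ∷ sorted) (0<a ∷ _) heavy | no b≰13 = contradiction
    (≤-trans heavy (+-mono-≤ (weight-antitone {1} z<s 0<a) (+-monoˡ-≤ 0ℚ (weight-antitone {14} z<s (ℕ.≰⇒> b≰13)))))
    (from-no (+ 13 / 20 ≤? weight 1 + (weight 14 + 0ℚ)))
  fold (suc n) a (b ∷ c ∷ xs) (s≤s len) (a≥b ∷ b≥c ∷ sorted) (0<a ∷ 0<b ∷ 0<c ∷ 0<xs) heavy | no b≰13
    with ⌈ b /2⌉ ℕ.≤? c
  -- By `m≤c`, the new list is again bounded by `c`. Sorting hides the structural descent, so the
  -- recursion runs on the length bound.
  ... | yes m≤c = merge b≥c (schedulable-↭ resorted
    (fold n c (Descending.sort (m ∷ xs)) (ℕ.≤-trans (ℕ.≤-reflexive (↭-length resorted)) len)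
      (cons-bounded (All-resp-↭ (↭-sym resorted) (m≤c ∷ linked⇒all sorted)) (Descending.sort-↗ (m ∷ xs)))
      (0<c ∷ All-resp-↭ (↭-sym resorted) (0<m ∷ 0<xs))
      (begin
        + 13 / 20                                                   ≤⟨ heavy ⟩
        weight a + (weight b + (weight c + totalWeight xs))         ≤⟨ +-monoˡ-≤ _ (weight-antitone 0<b a≥b) ⟩
        weight b + (weight b + (weight c + totalWeight xs))         ≡⟨ rearrange (weight b) (weight c) (totalWeight xs) ⟩
        weight c + ((weight b + weight b) + totalWeight xs)         ≤⟨ +-monoʳ-≤ (weight c) (+-monoˡ-≤ (totalWeight xs) (weight-half (ℕ.≰⇒> b≰13))) ⟩
        weight c + (weight m + totalWeight xs)                      ≡⟨ cong (_+_ (weight c)) (sym (totalWeight-↭ resorted)) ⟩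
        weight c + totalWeight (Descending.sort (m ∷ xs))           ∎)))
    where
    open ≤-Reasoning
    m = ⌈ b /2⌉
    0<m : 0 ℕ.< m
    0<m = ℕ.⌈n/2⌉-mono 0<b
    resorted : Descending.sort (m ∷ xs) ↭ m ∷ xs
    resorted = Descending.sort-↭ (m ∷ xs)
    rearrange : ∀ p q s → p + (p + (q + s)) ≡ q + ((p + p) + s)
    rearrange p q s = ≡.begin
      p + (p + (q + s))     ≡.≡⟨ sym (+-assoc p p (q + s)) ⟩
      (p + p) + (q + s)     ≡.≡⟨ sym (+-assoc (p + p) q s) ⟩
      ((p + p) + q) + s     ≡.≡⟨ cong (_+ s) (+-comm (p + p) q) ⟩
      (q + (p + p)) + s     ≡.≡⟨ +-assoc q (p + p) s ⟩
      q + ((p + p) + s)     ≡.∎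
      where module ≡ = ≡-Reasoning
  -- A merged job would break the bound `c`. But now `weight b + weight b ≤ weight m ≤ weight c`, so
  -- the new surplus alone pays for dropping `b`.
  ... | no m≰c = schedulable-∷ (fold n c (c ∷ xs) len (ℕ.≤-refl ∷ sorted) (0<c ∷ 0<c ∷ 0<xs)
    (begin
      + 13 / 20                                                   ≤⟨ heavy ⟩
      weight a + (weight b + totalWeight (c ∷ xs))                ≤⟨ +-monoˡ-≤ _ (weight-antitone 0<b a≥b) ⟩
      weight b + (weight b + totalWeight (c ∷ xs))                ≡⟨ sym (+-assoc (weight b) (weight b) _) ⟩
      (weight b + weight b) + totalWeight (c ∷ xs)                ≤⟨ +-monoˡ-≤ (totalWeight (c ∷ xs)) (≤-trans (weight-half (ℕ.≰⇒> b≰13)) (weight-antitone 0<c (ℕ.<⇒≤ (ℕ.≰⇒> m≰c)))) ⟩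
      weight c + totalWeight (c ∷ xs)                             ∎))
    where open ≤-Reasoning

  recip-nonneg : ∀ m → 0ℚ ≤ recip m
  recip-nonneg zero    = ≤-refl
  recip-nonneg (suc m) = nonNegative⁻¹ (recip (suc m)) {{normalize-nonNeg 1 (suc m)}}

  descending : ∀ xs → Linked ℕ._≥_ xs → All (0 ℕ.<_) xs → + 13 / 20 ≤ totalWeight xs → SchedulableList xs
  descending []       _      _            heavy = contradiction heavy (from-no (+ 13 / 20 ≤? 0ℚ))
  descending (b ∷ xs) sorted (0<b ∷ 0<xs) heavy =
    -- The longest period serves as its own initial bound; the surplus `weight b` comes for free.
    fold (length (b ∷ xs)) b (b ∷ xs) ℕ.≤-refl (ℕ.≤-refl ∷ sorted) (0<b ∷ 0<b ∷ 0<xs) (begin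
      + 13 / 20                          ≤⟨ heavy ⟩
      totalWeight (b ∷ xs)               ≡⟨ sym (+-identityˡ _) ⟩
      0ℚ + totalWeight (b ∷ xs)          ≤⟨ +-monoˡ-≤ _ (recip-nonneg (scale b)) ⟩
      weight b + totalWeight (b ∷ xs)    ∎)
    where open ≤-Reasoning

  ½-densitySum≤totalWeight : ∀ {n} (a : Instance n) → (∀ j → 0 ℕ.< a j) → ½ * densitySum a ≤ totalWeight (tabulate a)
  ½-densitySum≤totalWeight {zero}  a pos = ≤-refl
  ½-densitySum≤totalWeight {suc n} a pos = begin
    ½ * (recip (a zero) + densitySum (a ∘ suc))          ≡⟨ *-distribˡ-+ ½ (recip (a zero)) (densitySum (a ∘ suc)) ⟩
    ½ * recip (a zero) + ½ * densitySum (a ∘ suc)        ≤⟨ +-mono-≤ (½-recip≤weight (pos zero)) (½-densitySum≤totalWeight (a ∘ suc) (pos ∘ suc)) ⟩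
    weight (a zero) + totalWeight (tabulate (a ∘ suc))   ∎
    where open ≤-Reasoning

  dense⇒schedulable : ∀ {n} (a : Instance n) → (∀ j → 0 ℕ.< a j) → + 13 / 10 ≤ densitySum a → Schedulable a
  dense⇒schedulable a pos dense = schedulable-tabulate a (schedulable-↭ sorted
    (descending (Descending.sort xs) (Descending.sort-↗ xs) (All-resp-↭ (↭-sym sorted) (tabulate⁺ pos)) (begin
      ½ * (+ 13 / 10)                     ≤⟨ *-monoˡ-≤-nonNeg ½ dense ⟩
      ½ * densitySum a                    ≤⟨ ½-densitySum≤totalWeight a pos ⟩
      totalWeight xs                      ≡⟨ sym (totalWeight-↭ sorted) ⟩
      totalWeight (Descending.sort xs)    ∎)))
    where
    open ≤-Reasoning
    xs = tabulate a
    sorted : Descending.sort xs ↭ xs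
    sorted = Descending.sort-↭ xs

open import Data.Nat using (ℕ; _<_)
open import Data.Fin using (Fin)
open import Data.Integer using (+_)
open import Data.Rational using (_/_; _≤_)

theorem3p5 : (n : ℕ) (a : Instance n) → ((j : Fin n) → 0 < a j) →
    (+ 13 / 10) ≤ densitySum a → Schedulable a
theorem3p5 n a pos dense = Folding.dense⇒schedulable a pos dense
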